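{- Let $p$ be an odd prime, $n\ge3$, $2\le m\le n-1$, and let $I$ be the unsaturated generalized order ideal of $\mathbb{GH}(m,n)$ in which every element of $[n]$ has multiplicity $p-1$. Let $f:\mathbb{F}_p^n\to\mathbb{F}_p$ be the characteristic function of $I(\mathbb{GP})\setminus\{0\}$ (unsaturated notion). Then the code \[ \mathcal{C}_f=\{(sf(x)+u\cdot x)_{x\in\mathbb{F}_p^n\setminus0}:\ s\in\mathbb{F}_p,\ u\in\mathbb{F}_p^n\} \] violates the Ashikhmin--Barg condition.
   Context: $[n]=\{1,\dots,n\}$; $u\cdot x=\sum_i u_ix_i$. The Ashikhmin--Barg condition for a linear code over $\mathbb{F}_p$ is $w_{\min}/w_{\max}>(p-1)/p$, where $w_{\min},w_{\max}$ are the smallest and largest nonzero Hamming weights; a code violates it if the inequality fails. Generalized order ideals: $[n]_{p-1}$ is the multiset in which each $i\in[n]$ has multiplicity $p-1$. A sub-multiset $J$ is identified with its multiplicity vector $(J_1,\dots,J_n)\in\{0,\dots,p-1\}^n=\mathbb{F}_p^n$; $J\subseteq J'$ means $J_i\le J'_i$ (as integers) for all $i$; $\bar J=\{i:J_i\ne0\}$. The hierarchical poset $\mathbb{H}(m,n)$ on $[n]$ has as its only strict relations $i\prec j$ for all $i\in[m]$, $j\in[n]\setminus[m]$; $\mathbb{GH}(m,n)$ denotes $[n]_{p-1}$ together with this order. $J$ is an unsaturated generalized order ideal if $\bar J$ is an order ideal (down-closed subset) of $\mathbb{H}(m,n)$. For an unsaturated generalized order ideal $I$, $I(\mathbb{GP})\subseteq\mathbb{F}_p^n$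 is the set of all unsaturated generalized order ideals contained in $I$. Thus for the $I$ considered here, $I(\mathbb{GP})=(\mathbb{F}_p^m\times0)\cup((\mathbb{F}_p^*)^m\times(\mathbb{F}_p^{n-m}\setminus0))$. -}

module Defs where

open import Data.Bool.Base using (if_then_else_)
open import Data.Fin.Base as Fin using (Fin; toℕ)
import Data.Fin.Properties as Fin
open import Data.Integer.Base using (+_)
open import Data.List.Base using (List; []; _∷_; allFin; cartesianProductWith; filter; length)
open import Data.Nat.Base as ℕ using (ℕ; zero; suc; NonZero; _∸_)
open import Data.Nat.DivMod using (_mod_)
import Data.Nat.Properties as ℕ
open import Data.Product.Base using (∃-syntax; _×_)
open import Data.Rational.Base as ℚ using ()
open import Data.Vec.Base as Vec using (Vec; []; _∷_; lookup; replicate; foldr′; zipWith; count; fromList)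
import Data.Vec.Properties as Vec
open import Level using (0ℓ)
open import Relation.Binary.Core using (Rel)
open import Relation.Binary.Construct.Closure.Reflexive using (ReflClosure)
open import Relation.Binary.Construct.Closure.Reflexive.Properties using (dec)
import Relation.Binary.Definitions as Binary
open import Relation.Binary.PropositionalEquality.Core using (_≡_; _≢_)
open import Relation.Nullary using (¬_; does)
open import Relation.Nullary.Decidable using (¬?; _×-dec_; _→-dec_)
open import Relation.Unary using (Pred; Decidable)

-- 𝔽 p is a field only for p prime; its elements are the residues 0,…,p-1.
𝔽 : ℕ → Set
𝔽 p = Fin p

module _ {p : ℕ} .{{_ : NonZero p}} where

  infixl 6 _⊕_
  infixl 7 _⊗_ _·_

  𝟘 𝟙 : 𝔽 p
  𝟘 = 0 mod p
  𝟙 = 1 mod p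

  _⊕_ _⊗_ : 𝔽 p → 𝔽 p → 𝔽 p
  a ⊕ b = (toℕ a ℕ.+ toℕ b) mod p
  a ⊗ b = (toℕ a ℕ.* toℕ b) mod p

  𝟎 : ∀ {n} → Vec (𝔽 p) n
  𝟎 {n} = replicate n 𝟘

  _·_ : ∀ {n} → Vec (𝔽 p) n → Vec (𝔽 p) n → 𝔽 p
  u · x = foldr′ _⊕_ 𝟘 (zipWith _⊗_ u x)

  _≟𝔽ⁿ_ : ∀ {n} → Binary.DecidableEquality (Vec (𝔽 p) n)
  _≟𝔽ⁿ_ = Vec.≡-dec Fin._≟_

  indicator : {A : Set} {P : Pred A 0ℓ} → Decidable P → A → 𝔽 p
  indicator P? x = if does (P? x) then 𝟙 else 𝟘

-- Position i of a multiplicity vector stands for the element toℕ i + 1 of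
-- [n], so the subset [m] consists of the i with toℕ i < m.

Hierarchical≺ : (m n : ℕ) → Rel (Fin n) 0ℓ
Hierarchical≺ m n i j = toℕ i ℕ.< m × m ℕ.≤ toℕ j

Hierarchical≼ : (m n : ℕ) → Rel (Fin n) 0ℓ
Hierarchical≼ m n = ReflClosure (Hierarchical≺ m n)

hierarchical≼? : ∀ m n → Binary.Decidable (Hierarchical≼ m n)
hierarchical≼? m n = dec Fin._≟_ λ i j → (toℕ i ℕ.<? m) ×-dec (m ℕ.≤? toℕ j)

IsOrderIdeal : ∀ {n} → Rel (Fin n) 0ℓ → Pred (Pred (Fin n) 0ℓ) 0ℓ
IsOrderIdeal _≼_ S = ∀ i j → i ≼ j → S j → S i

-- A sub-multiset of [n]_{p-1} is its multiplicity vector, an element of 𝔽ₚⁿ.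
Multiset : ℕ → ℕ → Set
Multiset p n = Vec (𝔽 p) n

_⊆ₘ_ : ∀ {p n} → Rel (Multiset p n) 0ℓ
J ⊆ₘ J′ = ∀ i → lookup J i Fin.≤ lookup J′ i

supp : ∀ {p n} → Multiset p n → Pred (Fin n) 0ℓ
supp J i = toℕ (lookup J i) ≢ 0

module _ {n : ℕ} (_≼_ : Rel (Fin n) 0ℓ) where

  IsUnsaturatedIdeal : ∀ {p} → Pred (Multiset p n) 0ℓ
  IsUnsaturatedIdeal J = IsOrderIdeal _≼_ (supp J)

  IdealsIn : ∀ {p} → Multiset p n → Pred (Multiset p n) 0ℓ
  IdealsIn I J = IsUnsaturatedIdeal J × J ⊆ₘ I

  NonzeroIdealsIn : ∀ {p} .{{_ : NonZero p}} → Multiset p n → Pred (Multiset p n) 0ℓ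
  NonzeroIdealsIn I J = IdealsIn I J × J ≢ 𝟎

  module _ (_≼?_ : Binary.Decidable _≼_) where

    isUnsaturatedIdeal? : ∀ {p} → Decidable (IsUnsaturatedIdeal {p})
    isUnsaturatedIdeal? J = Fin.all? λ i → Fin.all? λ j →
      (i ≼? j) →-dec (¬? (toℕ (lookup J j) ℕ.≟ 0) →-dec ¬? (toℕ (lookup J i) ℕ.≟ 0))

    nonzeroIdealsIn? : ∀ {p} .{{_ : NonZero p}} (I : Multiset p n) →
                       Decidable (NonzeroIdealsIn I)
    nonzeroIdealsIn? I J =
      (isUnsaturatedIdeal? J ×-dec Fin.all? λ i → lookup J i Fin.≤? lookup I i)
        ×-dec ¬? (J ≟𝔽ⁿ 𝟎)

    charIdeals : ∀ {p} .{{_ : NonZero p}} → Multiset p n → Vec (𝔽 p) n → 𝔽 p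
    charIdeals I = indicator (nonzeroIdealsIn? I)

allVecs : ∀ p n → List (Vec (𝔽 p) n)
allVecs p zero    = [] ∷ []
allVecs p (suc n) = cartesianProductWith _∷_ (allFin p) (allVecs p n)

Code : ℕ → ℕ → Set₁
Code p N = Pred (Vec (𝔽 p) N) 0ℓ

module _ (p : ℕ) .{{_ : NonZero p}} where

  nonzeroPoints : ∀ n → List (Vec (𝔽 p) n)
  nonzeroPoints n = filter (λ x → ¬? (x ≟𝔽ⁿ 𝟎)) (allVecs p n)

  -- The coordinates of a word are indexed by the points of 𝔽ₚⁿ∖0, listed
  -- lexicographically.
  codeword : ∀ {n} → (Vec (𝔽 p) n → 𝔽 p) → 𝔽 p → Vec (𝔽 p) n →
             Vec (𝔽 p) (length (nonzeroPoints n))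
  codeword {n} f s u = Vec.map (λ x → s ⊗ f x ⊕ u · x) (fromList (nonzeroPoints n))

  codeOf : ∀ {n} → (Vec (𝔽 p) n → 𝔽 p) → Code p (length (nonzeroPoints n))
  codeOf f c = ∃[ s ] ∃[ u ] c ≡ codeword f s u

  module _ {N : ℕ} where

    weight : Vec (𝔽 p) N → ℕ
    weight = count (λ a → ¬? (a Fin.≟ 𝟘))

    IsNonzeroWeight : Code p N → Pred ℕ 0ℓ
    IsNonzeroWeight C w = w ≢ 0 × ∃[ c ] C c × weight c ≡ w

    IsMinWeight IsMaxWeight : Code p N → Pred ℕ 0ℓ
    IsMinWeight C w = IsNonzeroWeight C w × (∀ w′ → IsNonzeroWeight C w′ → w ℕ.≤ w′)
    IsMaxWeight C w = IsNonzeroWeight C w × (∀ w′ → IsNonzeroWeight C w′ → w′ ℕ.≤ w)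

    AshikhminBargInequality : (wmin wmax : ℕ) .{{_ : NonZero wmax}} → Set
    AshikhminBargInequality wmin wmax = (+ wmin ℚ./ wmax) ℚ.> (+ (p ∸ 1) ℚ./ p)

    -- The smallest and largest nonzero weights are asserted to exist, so that
    -- violation is not vacuous.
    record ViolatesAshikhminBarg (C : Code p N) : Set where
      field
        wmin wmax    : ℕ
        .{{wmax≢0}}  : NonZero wmax
        isMinWeight  : IsMinWeight C wmin
        isMaxWeight  : IsMaxWeight C wmax
        fails        : ¬ AshikhminBargInequality wmin wmax

{-# OPTIONS --safe #-}
module Submission where

-- Why the code violates the condition.  Put q = p - 1, k = n - m, P = p ^ k,
-- and split a point x of the whole space into a head y of length m and a tail
-- z of length k.  Since f and every linear form vanish at 0, the weight of the
-- word (s , u) is the number of all x with s f(x) + u·x nonzero, the point 0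
-- included.  The value f(x) is 1 when y has no zero entry; when y has a zero
-- entry it is 1 if z = 0 and y is nonzero, and 0 otherwise
-- (charIdeals-isSplitIndicator).
--
-- It suffices to find two words of weights A and B, with A nonzero, such that
-- p A is at most q B: then p wmin ≤ p A ≤ q B ≤ q wmax, which refutes
-- wmin / wmax > q / p.  The code is finite, so wmin and wmax exist (violates).
--
-- The heavy word is always f + x_{m+1}.  Summing over z for each fixed head y
-- gives q p ^ (k-1) if y is zero or has no zero entry, and one more otherwise;
-- hence its weight B satisfies B + 1 + q ^ m = p ^ m (q p ^ (k-1) + 1).
--
-- The light word depends on m.
--   m ≥ 3: the word of f, with A + 1 + q ^ m = p ^ m + q ^ m P (wt-𝟎).  The
--     inequality follows from p ^ (m-2) - q ^ (m-2) being at least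
--     q ^ (m-3) (power-gap, many-minimal-≤).
--   m = 2: here the word of f is too heavy, and f + x_1 is used.  The heads
--     with y_1 = 0 contribute at most 1 each, and those with y_1 = -1 and y_2
--     nonzero contribute nothing; all others contribute at most P.  So A is
--     at most q² P + q (wt-e₁, two-minimal-≤).

open import Defs
open import Data.Fin.Base using (Fin; zero; suc; toℕ; fromℕ; fromℕ<; _↑ˡ_; _↑ʳ_; reduce≥)
import Data.Fin.Properties as Fin
import Data.Integer.Base as ℤ
import Data.Integer.Properties as ℤ
open import Data.List.Base using (List; []; _∷_; _++_; allFin; cartesianProduct; cartesianProductWith; filter; map)
open import Data.List.Extrema.Nat using (min; max; argmin-sel; argmax-sel; min≤xs; xs≤max)
open import Data.List.Membership.Propositional using (_∈_)
open import Data.List.Membership.Propositional.Properties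
  using (∈-allFin; ∈-cartesianProduct⁺; ∈-cartesianProductWith⁺; ∈-filter⁺; ∈-filter⁻; ∈-map⁺; ∈-map⁻)
open import Data.List.Properties using (map-++; map-∘; map-tabulate)
open import Data.List.Relation.Unary.All as All using ()
open import Data.List.Relation.Unary.Any using (here; there)
open import Data.Nat.Base as ℕ using (ℕ; zero; suc; NonZero; _+_; _*_; _^_; _≤_; _<_; _≥_; _∸_; z≤n; s≤s)
open import Data.Nat.Divisibility using (_∣_; ∣-refl)
open import Data.Nat.DivMod using (_%_; m<n⇒m%n≡m; n%n≡0; _mod_)
open import Data.Nat.ListAction using (sum)
open import Data.Nat.ListAction.Properties using (sum-++)
open import Data.Nat.Primality using (Prime; ¬prime[0]; ¬prime[1])
open import Data.Nat.Properties as ℕ using (+-identityʳ; *-identityʳ; *-zeroʳ; +-suc; module ≤-Reasoning)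
open import Data.Nat.Tactic.RingSolver using (solve-∀)
open import Data.Product.Base using (∃-syntax; _×_; _,_; proj₁)
import Data.Rational.Base as ℚ
import Data.Rational.Properties as ℚ
import Data.Rational.Unnormalised.Base as ℚᵘ
import Data.Rational.Unnormalised.Properties as ℚᵘ
open import Data.Sum.Base using (inj₁; inj₂)
open import Data.Vec.Base as Vec using (Vec; []; _∷_; lookup)
open import Data.Vec.Properties using (lookup-++-<; lookup-++-≥; lookup-++ˡ; lookup-++ʳ; lookup-replicate; ++-injective)
open import Function.Base using (_∘_; id)
open import Relation.Binary.Construct.Closure.Reflexive using ([_]; refl)
open import Relation.Binary.PropositionalEquality
  using (_≡_; _≢_; refl; sym; trans; cong; cong₂; subst; subst₂; module ≡-Reasoning)
open import Relation.Nullary using (¬_; yes; no; contradiction)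
open import Relation.Nullary.Decidable using (¬?; dec-true; dec-false)
open import Level using (0ℓ)
open import Relation.Unary using (Pred; Decidable)

-- Finite sums over lists of points

-- The sum of h over a list, with multiplicity.
∑ : ∀ {A : Set} → List A → (A → ℕ) → ℕ
∑ xs h = sum (map h xs)

syntax ∑ xs (λ x → e) = ∑[ x ∈ xs ] e

module _ {A : Set} where

  ∑-cong : ∀ (xs : List A) {h g : A → ℕ} → (∀ x → h x ≡ g x) → ∑ xs h ≡ ∑ xs g
  ∑-cong []       e = refl
  ∑-cong (x ∷ xs) e = cong₂ _+_ (e x) (∑-cong xs e)

  ∑-mono : ∀ (xs : List A) {h g : A → ℕ} → (∀ x → h x ≤ g x) → ∑ xs h ≤ ∑ xs g
  ∑-mono []       e = z≤n
  ∑-mono (x ∷ xs) e = ℕ.+-mono-≤ (e x) (∑-mono xs e)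

  ∑-+ : ∀ (xs : List A) (h g : A → ℕ) → ∑[ x ∈ xs ] (h x + g x) ≡ ∑ xs h + ∑ xs g
  ∑-+ []       h g = refl
  ∑-+ (x ∷ xs) h g rewrite ∑-+ xs h g = interchange (h x) (g x) (∑ xs h) (∑ xs g)
    where
    interchange : ∀ a b c d → a + b + (c + d) ≡ a + c + (b + d)
    interchange = solve-∀

  ∑-*ʳ : ∀ (xs : List A) (h : A → ℕ) c → ∑[ x ∈ xs ] (h x * c) ≡ ∑ xs h * c
  ∑-*ʳ []       h c = refl
  ∑-*ʳ (x ∷ xs) h c rewrite ∑-*ʳ xs h c = sym (ℕ.*-distribʳ-+ c (h x) (∑ xs h))

  ∑-*ˡ : ∀ (xs : List A) (h : A → ℕ) c → ∑[ x ∈ xs ] (c * h x) ≡ c * ∑ xs h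
  ∑-*ˡ xs h c = begin
    ∑[ x ∈ xs ] (c * h x)  ≡⟨ ∑-cong xs (λ x → ℕ.*-comm c (h x)) ⟩
    ∑[ x ∈ xs ] (h x * c)  ≡⟨ ∑-*ʳ xs h c ⟩
    ∑ xs h * c             ≡⟨ ℕ.*-comm (∑ xs h) c ⟩
    c * ∑ xs h             ∎
    where open ≡-Reasoning

  term≤∑ : ∀ {xs : List A} (h : A → ℕ) {x} → x ∈ xs → h x ≤ ∑ xs h
  term≤∑ {y ∷ xs} h (here refl) = ℕ.m≤m+n (h y) (∑ xs h)
  term≤∑ {y ∷ xs} h (there x∈)  = ℕ.≤-trans (term≤∑ h x∈) (ℕ.m≤n+m (∑ xs h) (h y))

∑-cartesianProductWith : ∀ {A B C : Set} (f : A → B → C) xs ys (h : C → ℕ) →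
  ∑ (cartesianProductWith f xs ys) h ≡ ∑[ x ∈ xs ] ∑[ y ∈ ys ] h (f x y)
∑-cartesianProductWith f []       ys h = refl
∑-cartesianProductWith f (x ∷ xs) ys h = begin
  sum (map h (map (f x) ys ++ zs))          ≡⟨ cong sum (map-++ h (map (f x) ys) zs) ⟩
  sum (map h (map (f x) ys) ++ map h zs)    ≡⟨ sum-++ (map h (map (f x) ys)) (map h zs) ⟩
  sum (map h (map (f x) ys)) + ∑ zs h
    ≡⟨ cong₂ _+_ (cong sum (sym (map-∘ ys))) (∑-cartesianProductWith f xs ys h) ⟩
  ∑ ys (h ∘ f x) + ∑[ x ∈ xs ] ∑[ y ∈ ys ] h (f x y) ∎
  where
  open ≡-Reasoning
  zs = cartesianProductWith f xs ys

∑-allFin-suc : ∀ n (h : Fin (suc n) → ℕ) → ∑ (allFin (suc n)) h ≡ h zero + ∑ (allFin n) (h ∘ suc)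
∑-allFin-suc n h = cong (λ l → h zero + sum l)
  (trans (map-tabulate suc h) (sym (map-tabulate id (h ∘ suc))))

∑-allFin-const : ∀ n c → ∑[ _ ∈ allFin n ] c ≡ n * c
∑-allFin-const zero    c = refl
∑-allFin-const (suc n) c = trans (∑-allFin-suc n (λ _ → c)) (cong (c +_) (∑-allFin-const n c))

module _ {p : ℕ} where

  ∑-allVecs-suc : ∀ n (h : Vec (𝔽 p) (suc n) → ℕ) →
    ∑ (allVecs p (suc n)) h ≡ ∑[ a ∈ allFin p ] ∑[ v ∈ allVecs p n ] h (a ∷ v)
  ∑-allVecs-suc n = ∑-cartesianProductWith _∷_ (allFin p) (allVecs p n)

  ∑-allVecs-++ : ∀ m n (h : Vec (𝔽 p) (m + n) → ℕ) →
    ∑ (allVecs p (m + n)) h ≡ ∑[ y ∈ allVecs p m ] ∑[ z ∈ allVecs p n ] h (y Vec.++ z)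
  ∑-allVecs-++ zero    n h = sym (+-identityʳ _)
  ∑-allVecs-++ (suc m) n h = begin
    ∑ (allVecs p (suc m + n)) h
      ≡⟨ ∑-allVecs-suc (m + n) h ⟩
    ∑[ a ∈ allFin p ] ∑[ v ∈ allVecs p (m + n) ] h (a ∷ v)
      ≡⟨ ∑-cong (allFin p) (λ a → ∑-allVecs-++ m n (h ∘ (a ∷_))) ⟩
    ∑[ a ∈ allFin p ] ∑[ y ∈ allVecs p m ] ∑[ z ∈ allVecs p n ] h (a ∷ y Vec.++ z)
      ≡⟨ ∑-allVecs-suc m _ ⟨
    ∑[ y ∈ allVecs p (suc m) ] ∑[ z ∈ allVecs p n ] h (y Vec.++ z) ∎
    where open ≡-Reasoning

  ∑-allVecs-const : ∀ n c → ∑[ _ ∈ allVecs p n ] c ≡ p ^ n * c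
  ∑-allVecs-const zero    c = refl
  ∑-allVecs-const (suc n) c = begin
    ∑[ _ ∈ allVecs p (suc n) ] c                ≡⟨ ∑-allVecs-suc n (λ _ → c) ⟩
    ∑[ _ ∈ allFin p ] ∑[ _ ∈ allVecs p n ] c    ≡⟨ ∑-cong (allFin p) (λ _ → ∑-allVecs-const n c) ⟩
    ∑[ _ ∈ allFin p ] (p ^ n * c)               ≡⟨ ∑-allFin-const p (p ^ n * c) ⟩
    p * (p ^ n * c)                             ≡⟨ ℕ.*-assoc p (p ^ n) c ⟨
    p ^ suc n * c                               ∎
    where open ≡-Reasoning

  -- The product of h over the entries of a vector.  With h the indicator of a
  -- set of field elements this is the indicator of the vectors all of whose
  -- entries lie in that set.
  ∏ : ∀ {n} → (𝔽 p → ℕ) → Vec (𝔽 p) n → ℕ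
  ∏ h []      = 1
  ∏ h (a ∷ v) = h a * ∏ h v

  ∑-∏ : ∀ n (h : 𝔽 p → ℕ) → ∑ (allVecs p n) (∏ h) ≡ ∑ (allFin p) h ^ n
  ∑-∏ zero    h = refl
  ∑-∏ (suc n) h = begin
    ∑ (allVecs p (suc n)) (∏ h)                            ≡⟨ ∑-allVecs-suc n (∏ h) ⟩
    ∑[ a ∈ allFin p ] ∑[ v ∈ allVecs p n ] (h a * ∏ h v)
      ≡⟨ ∑-cong (allFin p) (λ a → ∑-*ˡ (allVecs p n) (∏ h) (h a)) ⟩
    ∑[ a ∈ allFin p ] (h a * ∑ (allVecs p n) (∏ h))        ≡⟨ ∑-*ʳ (allFin p) h _ ⟩
    ∑ (allFin p) h * ∑ (allVecs p n) (∏ h)                 ≡⟨ cong (∑ (allFin p) h *_) (∑-∏ n h) ⟩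
    ∑ (allFin p) h ^ suc n                                 ∎
    where open ≡-Reasoning

  ∈-allVecs : ∀ {n} (v : Vec (𝔽 p) n) → v ∈ allVecs p n
  ∈-allVecs []      = here refl
  ∈-allVecs (a ∷ v) = ∈-cartesianProductWith⁺ _∷_ (∈-allFin a) (∈-allVecs v)

-- Extremal weights and the Ashikhmin–Barg inequality

module _ (p : ℕ) .{{_ : NonZero p}} where

  ≤⇒¬AshikhminBarg : ∀ a b .{{_ : NonZero b}} → p * a ≤ (p ∸ 1) * b → ¬ AshikhminBargInequality p {0} a b
  ≤⇒¬AshikhminBarg a b pa≤qb a/b>q/p = ℚ.<-irrefl refl (ℚ.<-≤-trans a/b>q/p a/b≤q/p)
    where
    eq : ∀ c d .{{_ : NonZero d}} → ℚ.toℚᵘ (ℤ.+ c ℚ./ d) ℚᵘ.≃ (ℤ.+ c ℚᵘ./ d)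
    eq c (suc d) = ℚ.toℚᵘ-fromℚᵘ (ℤ.+ c ℚᵘ./ suc d)
    cross : ∀ a b c d .{{_ : NonZero b}} .{{_ : NonZero d}} → a * d ≤ c * b → (ℤ.+ a ℚᵘ./ b) ℚᵘ.≤ (ℤ.+ c ℚᵘ./ d)
    cross a (suc b) c (suc d) le = ℚᵘ.*≤* (subst₂ ℤ._≤_ (ℤ.pos-* a (suc d)) (ℤ.pos-* c (suc b)) (ℤ.+≤+ le))
    le : a * p ≤ (p ∸ 1) * b
    le = subst (_≤ (p ∸ 1) * b) (ℕ.*-comm p a) pa≤qb
    a/b≤q/p : ℤ.+ a ℚ./ b ℚ.≤ ℤ.+ (p ∸ 1) ℚ./ p
    a/b≤q/p = ℚ.toℚᵘ-cancel-≤
      (ℚᵘ.≤-respˡ-≃ (ℚᵘ.≃-sym (eq a b))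
        (ℚᵘ.≤-respʳ-≃ (ℚᵘ.≃-sym (eq (p ∸ 1) p)) (cross a b (p ∸ 1) p le)))

  module _ {n : ℕ} (f : Vec (𝔽 p) n → 𝔽 p) where

    -- The weight of the word s f(x) + u·x.
    wordWeight : 𝔽 p × Vec (𝔽 p) n → ℕ
    wordWeight (s , u) = weight p (codeword p f s u)

    -- The parameters of all words.
    words : List (𝔽 p × Vec (𝔽 p) n)
    words = cartesianProduct (allFin p) (allVecs p n)

    -- All nonzero weights of the code, possibly repeated.
    nonzeroWeights : List ℕ
    nonzeroWeights = filter (λ w → ¬? (w ℕ.≟ 0))
      (map wordWeight words)

    ∈-nonzeroWeights⁺ : ∀ {w} → IsNonzeroWeight p (codeOf p f) w → w ∈ nonzeroWeights
    ∈-nonzeroWeights⁺ (w≢0 , _ , (s , u , refl) , refl) =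
      ∈-filter⁺ _ (∈-map⁺ wordWeight (∈-cartesianProduct⁺ (∈-allFin s) (∈-allVecs u))) w≢0

    ∈-nonzeroWeights⁻ : ∀ {w} → w ∈ nonzeroWeights → IsNonzeroWeight p (codeOf p f) w
    ∈-nonzeroWeights⁻ w∈ with ∈-filter⁻ (λ w → ¬? (w ℕ.≟ 0)) {xs = map wordWeight words} w∈
    ... | w∈′ , w≢0 with ∈-map⁻ wordWeight w∈′
    ... | (s , u) , _ , refl = w≢0 , _ , (s , u , refl) , refl

    -- The two given weights need not be extremal: they only bound the extremal
    -- ones.
    violates : ∀ {a b} → IsNonzeroWeight p (codeOf p f) a → IsNonzeroWeight p (codeOf p f) b →
               p * a ≤ (p ∸ 1) * b → ViolatesAshikhminBarg p (codeOf p f)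
    violates {a} {b} ca cb pa≤qb = record
      { wmin        = wmin
      ; wmax        = wmax
      ; wmax≢0      = wmax≢0
      ; isMinWeight = wmin-weight , λ _ c → All.lookup (min≤xs a nonzeroWeights) (∈-nonzeroWeights⁺ c)
      ; isMaxWeight = wmax-weight , λ _ c → All.lookup (xs≤max b nonzeroWeights) (∈-nonzeroWeights⁺ c)
      ; fails       = ≤⇒¬AshikhminBarg wmin wmax {{wmax≢0}} (begin
          p * wmin
            ≤⟨ ℕ.*-monoʳ-≤ p (All.lookup (min≤xs a nonzeroWeights) (∈-nonzeroWeights⁺ ca)) ⟩
          p * a           ≤⟨ pa≤qb ⟩
          (p ∸ 1) * b
            ≤⟨ ℕ.*-monoʳ-≤ (p ∸ 1) (All.lookup (xs≤max b nonzeroWeights) (∈-nonzeroWeights⁺ cb)) ⟩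
          (p ∸ 1) * wmax  ∎)
      }
      where
      open ≤-Reasoning
      wmin = min a nonzeroWeights
      wmax = max b nonzeroWeights
      wmin-weight : IsNonzeroWeight p (codeOf p f) wmin
      wmin-weight with argmin-sel id a nonzeroWeights
      ... | inj₁ ≡a = subst (IsNonzeroWeight p (codeOf p f)) (sym ≡a) ca
      ... | inj₂ ∈ws = ∈-nonzeroWeights⁻ ∈ws
      wmax-weight : IsNonzeroWeight p (codeOf p f) wmax
      wmax-weight with argmax-sel id b nonzeroWeights
      ... | inj₁ ≡b = subst (IsNonzeroWeight p (codeOf p f)) (sym ≡b) cb
      ... | inj₂ ∈ws = ∈-nonzeroWeights⁻ ∈ws
      wmax≢0 : NonZero wmax
      wmax≢0 = ℕ.≢-nonZero (proj₁ wmax-weight)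

-- Indicators of residues, and their sums

-- The indicator of the nonzero residues.
nz : ∀ {n} → Fin n → ℕ
nz zero    = 0
nz (suc _) = 1

-- The indicator of the residue 0.
δ : ∀ {n} → Fin n → ℕ
δ zero    = 1
δ (suc _) = 0

nz≤1 : ∀ {n} (a : Fin n) → nz a ≤ 1
nz≤1 zero    = z≤n
nz≤1 (suc _) = s≤s z≤n

nz-+-δ : ∀ {n} (a : Fin n) → nz a + δ a ≡ 1
nz-+-δ zero    = refl
nz-+-δ (suc _) = refl

∑-nz : ∀ n → ∑ (allFin (suc n)) nz ≡ n
∑-nz n = trans (∑-allFin-suc n nz) (trans (∑-allFin-const n 1) (*-identityʳ n))

∑-δ : ∀ n → ∑ (allFin (suc n)) δ ≡ 1
∑-δ n = trans (∑-allFin-suc n δ) (cong suc (trans (∑-allFin-const n 0) (*-zeroʳ n)))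

-- The indicator of equality.
[_≟_] : ∀ {n} → Fin n → Fin n → ℕ
[ zero  ≟ a     ] = δ a
[ suc b ≟ zero  ] = 0
[ suc b ≟ suc a ] = [ b ≟ a ]

[≟]-refl : ∀ {n} (b : Fin n) → [ b ≟ b ] ≡ 1
[≟]-refl zero    = refl
[≟]-refl (suc b) = [≟]-refl b

[≟]-≢ : ∀ {n} {b a : Fin n} → b ≢ a → [ b ≟ a ] ≡ 0
[≟]-≢ {b = zero}  {zero}  b≢a = contradiction refl b≢a
[≟]-≢ {b = zero}  {suc a} b≢a = refl
[≟]-≢ {b = suc b} {zero}  b≢a = refl
[≟]-≢ {b = suc b} {suc a} b≢a = [≟]-≢ (b≢a ∘ cong suc)

∑-[≟] : ∀ {n} (b : Fin n) → ∑[ a ∈ allFin n ] [ b ≟ a ] ≡ 1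
∑-[≟] {suc n} zero    = ∑-δ n
∑-[≟] {suc n} (suc b) = trans (∑-allFin-suc n [ suc b ≟_]) (∑-[≟] b)

-- Linear forms modulo p

-- The modulus is p = q + 1 ≥ 2.
module Arithmetic (q-1 : ℕ) where

  q p : ℕ
  q = suc q-1
  p = suc q

  ∏-nz-full : ∀ {n} (v : Vec (𝔽 p) n) → (∀ i → lookup v i ≢ 𝟘) → ∏ nz v ≡ 1
  ∏-nz-full []          full = refl
  ∏-nz-full (zero  ∷ v) full = contradiction refl (full zero)
  ∏-nz-full (suc a ∷ v) full = trans (+-identityʳ _) (∏-nz-full v (full ∘ suc))

  ∏-nz-hole : ∀ {n} (v : Vec (𝔽 p) n) i → lookup v i ≡ 𝟘 → ∏ nz v ≡ 0
  ∏-nz-hole (_ ∷ v) zero    refl = refl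
  ∏-nz-hole (a ∷ v) (suc i) eq   = trans (cong (nz a *_) (∏-nz-hole v i eq)) (*-zeroʳ (nz a))

  ∏-δ-𝟎 : ∀ n → ∏ δ (𝟎 {p} {n}) ≡ 1
  ∏-δ-𝟎 zero    = refl
  ∏-δ-𝟎 (suc n) = trans (+-identityʳ _) (∏-δ-𝟎 n)

  ∏-δ-≢𝟎 : ∀ {n} (v : Vec (𝔽 p) n) → v ≢ 𝟎 → ∏ δ v ≡ 0
  ∏-δ-≢𝟎 []          v≢𝟎 = contradiction refl v≢𝟎
  ∏-δ-≢𝟎 (zero  ∷ v) v≢𝟎 = trans (+-identityʳ _) (∏-δ-≢𝟎 v (v≢𝟎 ∘ cong (zero ∷_)))
  ∏-δ-≢𝟎 (suc a ∷ v) v≢𝟎 = refl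

  ∑-∏-nz : ∀ n → ∑ (allVecs p n) (∏ nz) ≡ q ^ n
  ∑-∏-nz n = trans (∑-∏ n nz) (cong (_^ n) (∑-nz q))

  ∑-∏-δ : ∀ n → ∑ (allVecs p n) (∏ δ) ≡ 1
  ∑-∏-δ n = trans (∑-∏ n δ) (trans (cong (_^ n) (∑-δ q)) (ℕ.^-zeroˡ n))

  toℕ-mod : ∀ (a : 𝔽 p) → toℕ a mod p ≡ a
  toℕ-mod a = Fin.toℕ-injective (trans (Fin.toℕ-fromℕ< _) (m<n⇒m%n≡m (Fin.toℕ<n a)))

  ⊕-identityˡ : ∀ (a : 𝔽 p) → 𝟘 ⊕ a ≡ a
  ⊕-identityˡ = toℕ-mod

  ⊕-identityʳ : ∀ (a : 𝔽 p) → a ⊕ 𝟘 ≡ a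
  ⊕-identityʳ a = trans (cong (_mod p) (+-identityʳ (toℕ a))) (toℕ-mod a)

  ⊗-identityˡ : ∀ (a : 𝔽 p) → 𝟙 ⊗ a ≡ a
  ⊗-identityˡ a = trans (cong (_mod p) (+-identityʳ (toℕ a))) (toℕ-mod a)

  ⊗-zeroʳ : ∀ (a : 𝔽 p) → a ⊗ 𝟘 ≡ 𝟘
  ⊗-zeroʳ a = cong (_mod p) (*-zeroʳ (toℕ a))

  𝟎-dot : ∀ {n} (v : Vec (𝔽 p) n) → 𝟎 · v ≡ 𝟘
  𝟎-dot []      = refl
  𝟎-dot (a ∷ v) = cong (𝟘 ⊕_) (𝟎-dot v)

  dot-𝟎 : ∀ {n} (u : Vec (𝔽 p) n) → u · 𝟎 ≡ 𝟘
  dot-𝟎 []      = refl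
  dot-𝟎 (a ∷ u) = cong₂ _⊕_ (⊗-zeroʳ a) (dot-𝟎 u)

  -- The first unit vector.
  e₁ : ∀ {n} → Vec (𝔽 p) (suc n)
  e₁ = 𝟙 ∷ 𝟎

  e₁-dot : ∀ {n} a (v : Vec (𝔽 p) n) → e₁ · (a ∷ v) ≡ a
  e₁-dot a v = trans (cong₂ _⊕_ (⊗-identityˡ a) (𝟎-dot v)) (⊕-identityʳ a)

  𝟎++-dot : ∀ {m n} (u : Vec (𝔽 p) n) (y : Vec (𝔽 p) m) z → (𝟎 Vec.++ u) · (y Vec.++ z) ≡ u · z
  𝟎++-dot u []      z = refl
  𝟎++-dot u (_ ∷ y) z = trans (cong (𝟘 ⊕_) (𝟎++-dot u y z)) (⊕-identityˡ (u · z))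

  -- 1 + a vanishes exactly at the largest residue, a = q.
  δ-𝟙⊕ : ∀ (a : 𝔽 p) → δ (𝟙 ⊕ a) ≡ [ fromℕ q ≟ a ]
  δ-𝟙⊕ a with fromℕ q Fin.≟ a
  ... | yes refl = trans (cong δ 𝟙⊕q) (sym ([≟]-refl (fromℕ q)))
    where
    𝟙⊕q : 𝟙 ⊕ fromℕ q ≡ 𝟘
    𝟙⊕q = Fin.toℕ-injective (trans (Fin.toℕ-fromℕ< _)
            (trans (cong (λ x → suc x % p) (Fin.toℕ-fromℕ q)) (n%n≡0 p)))
  ... | no q≢a = trans (cong δ 𝟙⊕a) (sym ([≟]-≢ q≢a))
    where
    a<q : toℕ a < q
    a<q = ℕ.≤∧≢⇒< (Fin.toℕ≤pred[n] a) (λ e → q≢a (Fin.toℕ-injective (trans (Fin.toℕ-fromℕ q) (sym e))))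
    𝟙⊕a : 𝟙 ⊕ a ≡ suc (fromℕ< a<q)
    𝟙⊕a = Fin.toℕ-injective (trans (Fin.toℕ-fromℕ< _)
            (trans (m<n⇒m%n≡m (s≤s a<q)) (cong suc (sym (Fin.toℕ-fromℕ< a<q)))))

  ∑-δ-𝟙⊕ : ∑[ a ∈ allFin p ] δ (𝟙 ⊕ a) ≡ 1
  ∑-δ-𝟙⊕ = trans (∑-cong (allFin p) δ-𝟙⊕) (∑-[≟] (fromℕ q))

  ∑-nz-𝟙⊕ : ∑[ a ∈ allFin p ] nz (𝟙 ⊕ a) ≡ q
  ∑-nz-𝟙⊕ = ℕ.+-cancelʳ-≡ 1 _ q (begin
    ∑[ a ∈ allFin p ] nz (𝟙 ⊕ a) + 1
      ≡⟨ cong (∑[ a ∈ allFin p ] nz (𝟙 ⊕ a) +_) ∑-δ-𝟙⊕ ⟨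
    ∑[ a ∈ allFin p ] nz (𝟙 ⊕ a) + ∑[ a ∈ allFin p ] δ (𝟙 ⊕ a)
      ≡⟨ ∑-+ (allFin p) (λ a → nz (𝟙 ⊕ a)) (λ a → δ (𝟙 ⊕ a)) ⟨
    ∑[ a ∈ allFin p ] (nz (𝟙 ⊕ a) + δ (𝟙 ⊕ a))
      ≡⟨ ∑-cong (allFin p) (λ a → nz-+-δ (𝟙 ⊕ a)) ⟩
    ∑[ a ∈ allFin p ] 1                                           ≡⟨ ∑-allFin-const p 1 ⟩
    p * 1                                                         ≡⟨ *-identityʳ p ⟩
    p                                                             ≡⟨ ℕ.+-comm 1 q ⟩
    q + 1                                                         ∎)
    where open ≡-Reasoning

  -- Removing points where g vanishes does not change the number of points where
  -- it does not vanish.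
  weight-map-filter : ∀ {A : Set} {Q : Pred A 0ℓ} (Q? : Decidable Q) (g : A → 𝔽 p) →
    (∀ x → ¬ Q x → g x ≡ 𝟘) → ∀ xs →
    weight p (Vec.map g (Vec.fromList (filter Q? xs))) ≡ ∑ xs (nz ∘ g)
  weight-map-filter Q? g off []       = refl
  weight-map-filter Q? g off (x ∷ xs) with Q? x
  ... | no ¬Qx rewrite off x ¬Qx = weight-map-filter Q? g off xs
  ... | yes _ with g x
  ... | zero  = weight-map-filter Q? g off xs
  ... | suc _ = cong suc (weight-map-filter Q? g off xs)

  module _ {n : ℕ} (f : Vec (𝔽 p) n → 𝔽 p) (f𝟎≡𝟘 : f 𝟎 ≡ 𝟘) where

    weight-codeword : ∀ s u → weight p (codeword p f s u) ≡ ∑[ x ∈ allVecs p n ] nz (s ⊗ f x ⊕ u · x)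
    weight-codeword s u = weight-map-filter (λ x → ¬? (x ≟𝔽ⁿ 𝟎)) (λ x → s ⊗ f x ⊕ u · x) at-𝟎 (allVecs p n)
      where
      at-𝟎 : ∀ x → ¬ (x ≢ 𝟎) → s ⊗ f x ⊕ u · x ≡ 𝟘
      at-𝟎 x ¬x≢𝟎 with x ≟𝔽ⁿ 𝟎
      ... | yes refl = cong₂ _⊕_ (trans (cong (s ⊗_) f𝟎≡𝟘) (⊗-zeroʳ s)) (dot-𝟎 u)
      ... | no x≢𝟎   = contradiction x≢𝟎 ¬x≢𝟎

  -- The characteristic function of the ideals

  module _ {n m : ℕ} (I : Multiset p n) (I-full : ∀ i → toℕ (lookup I i) ≡ q) where

    below-full : (J : Multiset p n) → J ⊆ₘ I
    below-full J i = subst (toℕ (lookup J i) ≤_) (sym (I-full i)) (Fin.toℕ≤pred[n] (lookup J i))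

    charIdeals-𝟙 : ∀ x → IsUnsaturatedIdeal (Hierarchical≼ m n) x → x ≢ 𝟎 →
      charIdeals (Hierarchical≼ m n) (hierarchical≼? m n) I x ≡ 𝟙
    charIdeals-𝟙 x ideal x≢𝟎
      rewrite dec-true (nonzeroIdealsIn? (Hierarchical≼ m n) (hierarchical≼? m n) I x)
                       ((ideal , below-full x) , x≢𝟎) = refl

    charIdeals-𝟘 : ∀ x → ¬ NonzeroIdealsIn (Hierarchical≼ m n) I x →
      charIdeals (Hierarchical≼ m n) (hierarchical≼? m n) I x ≡ 𝟘
    charIdeals-𝟘 x ¬S
      rewrite dec-false (nonzeroIdealsIn? (Hierarchical≼ m n) (hierarchical≼? m n) I x) ¬S = refl

  ≢𝟎⇒∃ : ∀ {n} (z : Vec (𝔽 p) n) → z ≢ 𝟎 → ∃[ j ] lookup z j ≢ 𝟘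
  ≢𝟎⇒∃ []          z≢𝟎 = contradiction refl z≢𝟎
  ≢𝟎⇒∃ (suc a ∷ z) z≢𝟎 = zero , λ ()
  ≢𝟎⇒∃ (zero  ∷ z) z≢𝟎 with ≢𝟎⇒∃ z (z≢𝟎 ∘ cong (zero ∷_))
  ... | j , zj≢𝟘 = suc j , zj≢𝟘

  𝟎-++ : ∀ m {k} → 𝟎 {p} {m} Vec.++ 𝟎 {p} {k} ≡ 𝟎
  𝟎-++ zero    = refl
  𝟎-++ (suc m) = cong (zero ∷_) (𝟎-++ m)

  module _ {m k : ℕ} (y : Vec (𝔽 p) m) (z : Vec (𝔽 p) k) where

    ++≡𝟎⇒ˡ : y Vec.++ z ≡ 𝟎 → y ≡ 𝟎
    ++≡𝟎⇒ˡ eq = proj₁ (++-injective y 𝟎 (trans eq (sym (𝟎-++ m))))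

    full⇒ideal : (∀ i → lookup y i ≢ 𝟘) → IsUnsaturatedIdeal (Hierarchical≼ m (m + k)) (y Vec.++ z)
    full⇒ideal full i .i refl xj = xj
    full⇒ideal full i j [ i<m , _ ] _ xi≡0 =
      full (fromℕ< i<m) (trans (sym (lookup-++-< y z i i<m)) (Fin.toℕ-injective xi≡0))

    hole⇒¬ideal : ∀ i → lookup y i ≡ 𝟘 → z ≢ 𝟎 → ¬ IsUnsaturatedIdeal (Hierarchical≼ m (m + k)) (y Vec.++ z)
    hole⇒¬ideal i yi≡𝟘 z≢𝟎 ideal with ≢𝟎⇒∃ z z≢𝟎
    ... | j , zj≢𝟘 = ideal (i ↑ˡ k) (m ↑ʳ j)
      [ subst (_< m) (sym (Fin.toℕ-↑ˡ i k)) (Fin.toℕ<n i)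
      , subst (m ≤_) (sym (Fin.toℕ-↑ʳ m j)) (ℕ.m≤m+n m (toℕ j)) ]
      (λ xj≡0 → zj≢𝟘 (trans (sym (lookup-++ʳ y z j)) (Fin.toℕ-injective xj≡0)))
      (cong toℕ (trans (lookup-++ˡ y z i) yi≡𝟘))

  tail-𝟎⇒ideal : ∀ {m k} (y : Vec (𝔽 p) m) → IsUnsaturatedIdeal (Hierarchical≼ m (m + k)) (y Vec.++ 𝟎)
  tail-𝟎⇒ideal y i .i refl xj = xj
  tail-𝟎⇒ideal y i j [ _ , j≥m ] xj≢0 _ = xj≢0 (cong toℕ
    (trans (lookup-++-≥ y 𝟎 j j≥m) (lookup-replicate (reduce≥ j j≥m) 𝟘)))

  -- A head has no zero entry, or is zero, or is nonzero with a zero entry.  For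
  -- nonempty heads the cases are disjoint.
  data Shape {m} : Vec (𝔽 p) m → Set where
    full  : ∀ {y} → (∀ i → lookup y i ≢ 𝟘) → Shape y
    null  : Shape 𝟎
    mixed : ∀ {y} i → lookup y i ≡ 𝟘 → y ≢ 𝟎 → Shape y

  shape : ∀ {m} (y : Vec (𝔽 p) m) → Shape y
  shape y with Fin.any? (λ i → lookup y i Fin.≟ 𝟘) | y ≟𝔽ⁿ 𝟎
  ... | no ¬hole      | _        = full (λ i yi≡𝟘 → ¬hole (i , yi≡𝟘))
  ... | yes _         | yes refl = null
  ... | yes (i , eq)  | no y≢𝟎   = mixed i eq y≢𝟎

  -- For m positive: f is the indicator of the points y ++ z other than 0 such
  -- that y has no zero entry or z is zero.
  record IsSplitIndicator (m k : ℕ) (f : Vec (𝔽 p) (m + k) → 𝔽 p) : Set where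
    field
      at-𝟎    : f 𝟎 ≡ 𝟘
      on-full : ∀ (y : Vec (𝔽 p) m) (z : Vec (𝔽 p) k) → (∀ i → lookup y i ≢ 𝟘) → f (y Vec.++ z) ≡ 𝟙
      on-tail : ∀ (y : Vec (𝔽 p) m) → y ≢ 𝟎 → f (y Vec.++ 𝟎) ≡ 𝟙
      on-hole : ∀ (y : Vec (𝔽 p) m) (z : Vec (𝔽 p) k) i → lookup y i ≡ 𝟘 → z ≢ 𝟎 → f (y Vec.++ z) ≡ 𝟘

  charIdeals-isSplitIndicator : ∀ m k .{{_ : NonZero m}} (I : Multiset p (m + k)) →
    (∀ i → toℕ (lookup I i) ≡ q) →
    IsSplitIndicator m k (charIdeals (Hierarchical≼ m (m + k)) (hierarchical≼? m (m + k)) I)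
  charIdeals-isSplitIndicator m@(suc _) k I I-full = record
    { at-𝟎    = charIdeals-𝟘 {m = m} I I-full 𝟎 (λ (_ , 𝟎≢𝟎) → 𝟎≢𝟎 refl)
    ; on-full = λ y z y-full → charIdeals-𝟙 {m = m} I I-full (y Vec.++ z) (full⇒ideal y z y-full)
        (λ yz≡𝟎 → y-full zero (cong (λ v → lookup v zero) (++≡𝟎⇒ˡ y z yz≡𝟎)))
    ; on-tail = λ y y≢𝟎 → charIdeals-𝟙 {m = m} I I-full (y Vec.++ 𝟎) (tail-𝟎⇒ideal y) (y≢𝟎 ∘ ++≡𝟎⇒ˡ y 𝟎)
    ; on-hole = λ y z i yi≡𝟘 z≢𝟎 → charIdeals-𝟘 {m = m} I I-full (y Vec.++ z)
        (λ ((ideal , _) , _) → hole⇒¬ideal y z i yi≡𝟘 z≢𝟎 ideal)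
    }

  -- Weights of the words f(x) + u·x

  module Words (m-2 k-1 : ℕ) (f : Vec (𝔽 p) (2 + m-2 + suc k-1) → 𝔽 p)
               (isSplit : IsSplitIndicator (2 + m-2) (suc k-1) f) where

    m k n : ℕ
    m = 2 + m-2
    k = suc k-1
    n = m + k

    ys : List (Vec (𝔽 p) m)
    ys = allVecs p m

    zs : List (Vec (𝔽 p) k)
    zs = allVecs p k

    open IsSplitIndicator isSplit public
      renaming (at-𝟎 to f-𝟎; on-full to f-full; on-tail to f-tail-𝟎; on-hole to f-hole)

    f-null : ∀ (z : Vec (𝔽 p) k) → f (𝟎 {n = m} Vec.++ z) ≡ 𝟘
    f-null z with z ≟𝔽ⁿ 𝟎
    ... | yes refl = trans (cong f (𝟎-++ m)) f-𝟎
    ... | no z≢𝟎   = f-hole 𝟎 z zero refl z≢𝟎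

    -- 1 or 0 according as the word of (1 , u) is nonzero at x or not.
    value : Vec (𝔽 p) n → Vec (𝔽 p) n → ℕ
    value u x = nz (𝟙 ⊗ f x ⊕ u · x)

    value-≡ : ∀ u x {a b} → f x ≡ a → u · x ≡ b → value u x ≡ nz (𝟙 ⊗ a ⊕ b)
    value-≡ u x fx≡a ux≡b = cong₂ (λ a b → nz (𝟙 ⊗ a ⊕ b)) fx≡a ux≡b

    -- Above a nonzero head with a zero entry, f is the indicator of z = 0; where
    -- u·x = 0, so is the word.
    value-mixed : ∀ u y z i → lookup y i ≡ 𝟘 → y ≢ 𝟎 → u · (y Vec.++ z) ≡ 𝟘 →
                  value u (y Vec.++ z) ≡ ∏ δ z
    value-mixed u y z i yi≡𝟘 y≢𝟎 uyz≡𝟘 with z ≟𝔽ⁿ 𝟎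
    ... | yes refl = trans (value-≡ u _ (f-tail-𝟎 y y≢𝟎) uyz≡𝟘) (sym (∏-δ-𝟎 k))
    ... | no z≢𝟎   = trans (value-≡ u _ (f-hole y z i yi≡𝟘 z≢𝟎) uyz≡𝟘) (sym (∏-δ-≢𝟎 z z≢𝟎))

    -- The weight of the word of (1 , u); see weight-codeword.
    wt : Vec (𝔽 p) n → ℕ
    wt u = ∑ (allVecs p n) (value u)

    -- The contribution to wt u of the points with head y.
    fibre : Vec (𝔽 p) n → Vec (𝔽 p) m → ℕ
    fibre u y = ∑[ z ∈ zs ] value u (y Vec.++ z)

    wt-fibre : ∀ u → wt u ≡ ∑ ys (fibre u)
    wt-fibre u = ∑-allVecs-++ m k (value u)

    -- Of the heads y, one is zero and q ^ m have no zero entry, so adding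
    -- ∏ δ y + ∏ nz y to every fibre adds 1 + q ^ m to the weight.
    wt-corrected : ∀ u → wt u + 1 + q ^ m ≡ ∑[ y ∈ ys ] (fibre u y + ∏ δ y + ∏ nz y)
    wt-corrected u = begin
      wt u + 1 + q ^ m
        ≡⟨ cong₂ _+_ (cong₂ _+_ (wt-fibre u) (sym (∑-∏-δ m))) (sym (∑-∏-nz m)) ⟩
      ∑ ys (fibre u) + ∑ ys (∏ δ) + ∑ ys (∏ nz)
        ≡⟨ cong (_+ ∑ ys (∏ nz)) (∑-+ ys (fibre u) (∏ δ)) ⟨
      ∑[ y ∈ ys ] (fibre u y + ∏ δ y) + ∑ ys (∏ nz)
        ≡⟨ ∑-+ ys (λ y → fibre u y + ∏ δ y) (∏ nz) ⟨
      ∑[ y ∈ ys ] (fibre u y + ∏ δ y + ∏ nz y) ∎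
      where open ≡-Reasoning

    -- The word of f itself


    -- The fibre contributes P, 0 or 1 according as the head has no zero entry, is
    -- zero, or is nonzero with a zero entry.
    fibre-𝟎 : ∀ y → fibre 𝟎 y + ∏ δ y + ∏ nz y ≡ 1 + ∏ nz y * p ^ k
    fibre-𝟎 y with shape y
    ... | full y-full rewrite ∏-nz-full y y-full | ∏-δ-≢𝟎 y (λ { refl → y-full zero refl }) = begin
      fibre 𝟎 y + 0 + 1
        ≡⟨ cong (λ w → w + 0 + 1)
           (∑-cong zs (λ z → value-≡ 𝟎 _ (f-full y z y-full) (𝟎-dot (y Vec.++ z)))) ⟩
      ∑[ z ∈ zs ] 1 + 0 + 1  ≡⟨ cong (λ w → w + 0 + 1) (∑-allVecs-const {p} k 1) ⟩
      p ^ k * 1 + 0 + 1   ≡⟨ arith (p ^ k) ⟩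
      1 + 1 * p ^ k       ∎
      where
      open ≡-Reasoning
      arith : ∀ P → P * 1 + 0 + 1 ≡ 1 + 1 * P
      arith = solve-∀
    ... | null rewrite ∏-δ-𝟎 m = begin
      fibre 𝟎 𝟎 + 1 + 0
        ≡⟨ cong (λ w → w + 1 + 0)
           (∑-cong zs (λ z → value-≡ 𝟎 _ (f-null z) (𝟎-dot (𝟎 {n = m} Vec.++ z)))) ⟩
      ∑[ z ∈ zs ] 0 + 1 + 0
        ≡⟨ cong (λ w → w + 1 + 0) (trans (∑-allVecs-const {p} k 0) (*-zeroʳ (p ^ k))) ⟩
      1                   ∎
      where open ≡-Reasoning
    ... | mixed i yi≡𝟘 y≢𝟎 rewrite ∏-nz-hole y i yi≡𝟘 | ∏-δ-≢𝟎 y y≢𝟎 = begin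
      fibre 𝟎 y + 0 + 0
        ≡⟨ cong (λ w → w + 0 + 0) (∑-cong zs (λ z → value-mixed 𝟎 y z i yi≡𝟘 y≢𝟎 (𝟎-dot (y Vec.++ z)))) ⟩
      ∑ zs (∏ δ) + 0 + 0   ≡⟨ cong (λ w → w + 0 + 0) (∑-∏-δ k) ⟩
      1                   ∎
      where open ≡-Reasoning

    wt-𝟎 : wt 𝟎 + 1 + q ^ m ≡ p ^ m + q ^ m * p ^ k
    wt-𝟎 = begin
      wt 𝟎 + 1 + q ^ m
        ≡⟨ wt-corrected 𝟎 ⟩
      ∑[ y ∈ ys ] (fibre 𝟎 y + ∏ δ y + ∏ nz y)
        ≡⟨ ∑-cong ys fibre-𝟎 ⟩
      ∑[ y ∈ ys ] (1 + ∏ nz y * p ^ k)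
        ≡⟨ ∑-+ ys (λ _ → 1) (λ y → ∏ nz y * p ^ k) ⟩
      ∑[ y ∈ ys ] 1 + ∑[ y ∈ ys ] (∏ nz y * p ^ k)
        ≡⟨ cong₂ _+_ (trans (∑-allVecs-const {p} m 1) (*-identityʳ (p ^ m)))
                     (trans (∑-*ʳ ys (∏ nz) (p ^ k)) (cong (_* p ^ k) (∑-∏-nz m))) ⟩
      p ^ m + q ^ m * p ^ k ∎
      where open ≡-Reasoning

    -- The word of f + x_{m+1}

    -- The unit vector of the first tail coordinate.
    e-tail : Vec (𝔽 p) n
    e-tail = 𝟎 {n = m} Vec.++ e₁

    e-tail-dot : ∀ (y : Vec (𝔽 p) m) a (z : Vec (𝔽 p) k-1) → e-tail · (y Vec.++ a ∷ z) ≡ a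
    e-tail-dot y a z = trans (𝟎++-dot e₁ y (a ∷ z)) (e₁-dot a z)

    -- The remaining tail coordinates are free.
    ∑-first : ∀ (h : 𝔽 p → ℕ) {s} → ∑ (allFin p) h ≡ s →
              ∑[ z ∈ zs ] h (Vec.head z) ≡ p ^ k-1 * s
    ∑-first h {s} ∑h≡s = begin
      ∑[ z ∈ zs ] h (Vec.head z)             ≡⟨ ∑-allVecs-suc k-1 (h ∘ Vec.head) ⟩
      ∑[ a ∈ allFin p ] ∑[ _ ∈ allVecs p k-1 ] h a
        ≡⟨ ∑-cong (allFin p) (λ a → ∑-allVecs-const {p} k-1 (h a)) ⟩
      ∑[ a ∈ allFin p ] (p ^ k-1 * h a)               ≡⟨ ∑-*ˡ (allFin p) h (p ^ k-1) ⟩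
      p ^ k-1 * ∑ (allFin p) h                        ≡⟨ cong (p ^ k-1 *_) ∑h≡s ⟩
      p ^ k-1 * s                                     ∎
      where open ≡-Reasoning

    value-e-tail-mixed : ∀ (y : Vec (𝔽 p) m) a (z : Vec (𝔽 p) k-1) i → lookup y i ≡ 𝟘 → y ≢ 𝟎 →
      value e-tail (y Vec.++ a ∷ z) ≡ nz a + ∏ δ (a ∷ z)
    value-e-tail-mixed y zero z i yi≡𝟘 y≢𝟎 = value-mixed e-tail y (zero ∷ z) i yi≡𝟘 y≢𝟎 (e-tail-dot y zero z)
    value-e-tail-mixed y a@(suc _) z i yi≡𝟘 y≢𝟎 = begin
      value e-tail (y Vec.++ a ∷ z)
        ≡⟨ value-≡ e-tail _ (f-hole y (a ∷ z) i yi≡𝟘 (λ ())) (e-tail-dot y a z) ⟩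
      nz (𝟘 ⊕ a)                     ≡⟨ cong nz (⊕-identityˡ a) ⟩
      1                              ∎
      where open ≡-Reasoning

    -- The fibre contributes q p ^ (k-1), plus 1 if the head is nonzero with a zero
    -- entry.
    fibre-e-tail : ∀ y → fibre e-tail y + ∏ δ y + ∏ nz y ≡ p ^ k-1 * q + 1
    fibre-e-tail y with shape y
    ... | full y-full rewrite ∏-nz-full y y-full | ∏-δ-≢𝟎 y (λ { refl → y-full zero refl }) = begin
      fibre e-tail y + 0 + 1  ≡⟨ cong (_+ 1) (+-identityʳ _) ⟩
      fibre e-tail y + 1
        ≡⟨ cong (_+ 1) (∑-cong zs (λ { z@(a ∷ z′) → value-≡ e-tail _ (f-full y z y-full) (e-tail-dot y a z′) })) ⟩
      ∑[ z ∈ zs ] nz (𝟙 ⊕ Vec.head z) + 1  ≡⟨ cong (_+ 1) (∑-first (λ a → nz (𝟙 ⊕ a)) ∑-nz-𝟙⊕) ⟩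
      p ^ k-1 * q + 1 ∎
      where open ≡-Reasoning
    ... | null rewrite ∏-δ-𝟎 m = begin
      fibre e-tail 𝟎 + 1 + 0  ≡⟨ +-identityʳ _ ⟩
      fibre e-tail 𝟎 + 1      ≡⟨ cong (_+ 1) (∑-cong zs (λ { z@(a ∷ z′) →
                                   trans (value-≡ e-tail _ (f-null z) (e-tail-dot 𝟎 a z′)) (cong nz (⊕-identityˡ a)) })) ⟩
      ∑[ z ∈ zs ] nz (Vec.head z) + 1  ≡⟨ cong (_+ 1) (∑-first nz (∑-nz q)) ⟩
      p ^ k-1 * q + 1 ∎
      where open ≡-Reasoning
    ... | mixed i yi≡𝟘 y≢𝟎 rewrite ∏-nz-hole y i yi≡𝟘 | ∏-δ-≢𝟎 y y≢𝟎 = begin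
      fibre e-tail y + 0 + 0  ≡⟨ trans (+-identityʳ _) (+-identityʳ _) ⟩
      fibre e-tail y          ≡⟨ ∑-cong zs (λ { (a ∷ z) → value-e-tail-mixed y a z i yi≡𝟘 y≢𝟎 }) ⟩
      ∑[ z ∈ zs ] (nz (Vec.head z) + ∏ δ z)  ≡⟨ ∑-+ zs (nz ∘ Vec.head) (∏ δ) ⟩
      ∑[ z ∈ zs ] nz (Vec.head z) + ∑ zs (∏ δ)
                              ≡⟨ cong₂ _+_ (∑-first nz (∑-nz q)) (∑-∏-δ k) ⟩
      p ^ k-1 * q + 1         ∎
      where open ≡-Reasoning

    wt-e-tail : wt e-tail + 1 + q ^ m ≡ p ^ m * (p ^ k-1 * q + 1)
    wt-e-tail = begin
      wt e-tail + 1 + q ^ m                                  ≡⟨ wt-corrected e-tail ⟩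
      ∑[ y ∈ ys ] (fibre e-tail y + ∏ δ y + ∏ nz y)          ≡⟨ ∑-cong ys fibre-e-tail ⟩
      ∑[ y ∈ ys ] (p ^ k-1 * q + 1)                          ≡⟨ ∑-allVecs-const {p} m _ ⟩
      p ^ m * (p ^ k-1 * q + 1)                              ∎
      where open ≡-Reasoning

    -- The second unit vector: f is 1 there, since its tail is zero, and both
    -- light words use a u that is orthogonal to it.
    witness : Vec (𝔽 p) n
    witness = (𝟘 ∷ 𝟙 ∷ 𝟎 {n = m-2}) Vec.++ 𝟎

    wt≢0 : ∀ u → u · witness ≡ 𝟘 → wt u ≢ 0
    wt≢0 u u·w≡𝟘 = ℕ.>⇒≢ (begin
      1                ≡⟨ value-≡ u witness (f-tail-𝟎 (𝟘 ∷ 𝟙 ∷ 𝟎) (λ ())) u·w≡𝟘 ⟨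
      value u witness  ≤⟨ term≤∑ (value u) (∈-allVecs witness) ⟩
      wt u             ∎)
      where open ≤-Reasoning

    violates-by : ∀ u v → wt u ≢ 0 → p * wt u ≤ q * wt v → ViolatesAshikhminBarg p (codeOf p f)
    violates-by u v wtu≢0 le = violates p f (word u wtu≢0) (word v wtv≢0) le
      where
      word : ∀ u → wt u ≢ 0 → IsNonzeroWeight p (codeOf p f) (wt u)
      word u wt≢0 = wt≢0 , _ , (𝟙 , u , refl) , weight-codeword f f-𝟎 𝟙 u
      wtv≢0 : wt v ≢ 0
      wtv≢0 wtv≡0 = wtu≢0 (ℕ.m*n≡0⇒m≡0 (wt u) p (ℕ.n≤0⇒n≡0 (begin
        wt u * p  ≡⟨ ℕ.*-comm (wt u) p ⟩
        p * wt u  ≤⟨ le ⟩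
        q * wt v  ≡⟨ cong (q *_) wtv≡0 ⟩
        q * 0     ≡⟨ *-zeroʳ q ⟩
        0         ∎)))
        where open ≤-Reasoning

  ∑-pairs : ∀ (g h : 𝔽 p → ℕ) →
    ∑[ y ∈ allVecs p 2 ] (g (lookup y zero) * h (lookup y (suc zero))) ≡ ∑ (allFin p) g * ∑ (allFin p) h
  ∑-pairs g h = begin
    ∑[ y ∈ allVecs p 2 ] (g (lookup y zero) * h (lookup y (suc zero)))
      ≡⟨ ∑-allVecs-suc {p} 1 (λ y → g (lookup y zero) * h (lookup y (suc zero))) ⟩
    ∑[ a ∈ allFin p ] ∑[ y ∈ allVecs p 1 ] (g a * h (lookup y zero))
      ≡⟨ ∑-cong (allFin p) (λ a → ∑-allVecs-suc {p} 0 (λ y → g a * h (lookup y zero))) ⟩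
    ∑[ a ∈ allFin p ] ∑[ b ∈ allFin p ] (g a * h b + 0)
      ≡⟨ ∑-cong (allFin p) (λ a → ∑-cong (allFin p) (λ b → +-identityʳ (g a * h b))) ⟩
    ∑[ a ∈ allFin p ] ∑[ b ∈ allFin p ] (g a * h b)
      ≡⟨ ∑-cong (allFin p) (λ a → ∑-*ˡ (allFin p) h (g a)) ⟩
    ∑[ a ∈ allFin p ] (g a * ∑ (allFin p) h)
      ≡⟨ ∑-*ʳ (allFin p) g _ ⟩
    ∑ (allFin p) g * ∑ (allFin p) h ∎
    where open ≡-Reasoning

  -- The word of f + x_1 for m = 2

  module TwoMinimal (k-1 : ℕ) (f : Vec (𝔽 p) (2 + suc k-1) → 𝔽 p)
                    (isSplit : IsSplitIndicator 2 (suc k-1) f) where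

    open Words 0 k-1 f isSplit

    P : ℕ
    P = p ^ k

    fibre≤ : ∀ u y → fibre u y ≤ P
    fibre≤ u y = begin
      fibre u y        ≤⟨ ∑-mono zs (λ z → nz≤1 _) ⟩
      ∑[ z ∈ zs ] 1    ≡⟨ ∑-allVecs-const {p} k 1 ⟩
      P * 1            ≡⟨ *-identityʳ P ⟩
      P                ∎
      where open ≤-Reasoning

    fibre-e₁-𝟘 : ∀ b → fibre e₁ (𝟘 ∷ b ∷ []) ≡ nz b
    fibre-e₁-𝟘 zero = begin
      fibre e₁ 𝟎       ≡⟨ ∑-cong zs (λ z → value-≡ e₁ _ (f-null z) (e₁-dot 𝟘 (𝟘 ∷ z))) ⟩
      ∑[ z ∈ zs ] 0    ≡⟨ ∑-allVecs-const {p} k 0 ⟩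
      P * 0            ≡⟨ *-zeroʳ P ⟩
      0                ∎
      where open ≡-Reasoning
    fibre-e₁-𝟘 b@(suc _) = trans
      (∑-cong zs (λ z → value-mixed e₁ (𝟘 ∷ b ∷ []) z zero refl (λ ()) (e₁-dot 𝟘 (b ∷ z))))
      (∑-∏-δ k)

    fibre-e₁-full : ∀ (a b : Fin q) → fibre e₁ (suc a ∷ suc b ∷ []) ≡ P * nz (𝟙 ⊕ suc a)
    fibre-e₁-full a b = trans
      (∑-cong zs (λ z → value-≡ e₁ _ (f-full y z y-full) (e₁-dot (suc a) (suc b ∷ z))))
      (∑-allVecs-const {p} k (nz (𝟙 ⊕ suc a)))
      where
      y : Vec (𝔽 p) 2
      y = suc a ∷ suc b ∷ []
      y-full : ∀ i → lookup y i ≢ 𝟘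
      y-full zero       ()
      y-full (suc zero) ()

    -- The factor δ (𝟙 ⊕ a) singles out a = -1.  For b nonzero the head then has
    -- no zero entry, so f + x_1 = 1 + a = 0 on the whole fibre.
    fibre-e₁ : ∀ a b → fibre e₁ (a ∷ b ∷ []) + δ a * P + δ (𝟙 ⊕ a) * (nz b * P) ≤ P + δ a * nz b
    fibre-e₁ zero b = ℕ.≤-reflexive (begin
      fibre e₁ (𝟘 ∷ b ∷ []) + 1 * P + 0   ≡⟨ cong (λ w → w + 1 * P + 0) (fibre-e₁-𝟘 b) ⟩
      nz b + 1 * P + 0                    ≡⟨ arith (nz b) P ⟩
      P + 1 * nz b                        ∎)
      where
      open ≡-Reasoning
      arith : ∀ x P → x + 1 * P + 0 ≡ P + 1 * x
      arith = solve-∀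
    fibre-e₁ a@(suc _) zero = begin
      fibre e₁ (a ∷ 𝟘 ∷ []) + 0 + δ (𝟙 ⊕ a) * 0
        ≡⟨ cong (fibre e₁ (a ∷ 𝟘 ∷ []) + 0 +_) (*-zeroʳ (δ (𝟙 ⊕ a))) ⟩
      fibre e₁ (a ∷ 𝟘 ∷ []) + 0 + 0               ≡⟨ trans (+-identityʳ _) (+-identityʳ _) ⟩
      fibre e₁ (a ∷ 𝟘 ∷ [])                       ≤⟨ fibre≤ e₁ _ ⟩
      P                                           ≡⟨ +-identityʳ P ⟨
      P + 0                                       ∎
      where open ≤-Reasoning
    fibre-e₁ a@(suc a′) (suc b′) = ℕ.≤-reflexive (begin
      fibre e₁ (a ∷ suc b′ ∷ []) + 0 + δ (𝟙 ⊕ a) * (1 * P)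
        ≡⟨ cong (λ w → w + 0 + δ (𝟙 ⊕ a) * (1 * P)) (fibre-e₁-full a′ b′) ⟩
      P * nz (𝟙 ⊕ a) + 0 + δ (𝟙 ⊕ a) * (1 * P)               ≡⟨ arith P (nz (𝟙 ⊕ a)) (δ (𝟙 ⊕ a)) ⟩
      P * (nz (𝟙 ⊕ a) + δ (𝟙 ⊕ a)) + 0                       ≡⟨ cong (λ w → P * w + 0) (nz-+-δ (𝟙 ⊕ a)) ⟩
      P * 1 + 0                                              ≡⟨ cong (_+ 0) (*-identityʳ P) ⟩
      P + 0                                                  ∎)
      where
      open ≡-Reasoning
      arith : ∀ P x d → P * x + 0 + d * (1 * P) ≡ P * (x + d) + 0
      arith = solve-∀

    wt-e₁ : wt e₁ + 1 * (p * P) + 1 * (q * P) ≤ p ^ 2 * P + 1 * q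
    wt-e₁ = begin
      wt e₁ + 1 * (p * P) + 1 * (q * P)
        ≡⟨ cong₂ _+_ (cong₂ _+_ (wt-fibre e₁) (sym ∑-zero)) (sym ∑-minus) ⟩
      ∑ ys (fibre e₁) + ∑ ys g + ∑ ys h
        ≡⟨ cong (_+ ∑ ys h) (∑-+ ys (fibre e₁) g) ⟨
      ∑[ y ∈ ys ] (fibre e₁ y + g y) + ∑ ys h
        ≡⟨ ∑-+ ys (λ y → fibre e₁ y + g y) h ⟨
      ∑[ y ∈ ys ] (fibre e₁ y + g y + h y)
        ≤⟨ ∑-mono ys bound ⟩
      ∑[ y ∈ ys ] (P + δ (lookup y zero) * nz (lookup y (suc zero)))
        ≡⟨ ∑-+ ys (λ _ → P) (λ y → δ (lookup y zero) * nz (lookup y (suc zero))) ⟩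
      ∑[ y ∈ ys ] P + ∑[ y ∈ ys ] (δ (lookup y zero) * nz (lookup y (suc zero)))
        ≡⟨ cong₂ _+_ (∑-allVecs-const {p} 2 P) (trans (∑-pairs δ nz) (cong₂ _*_ (∑-δ q) (∑-nz q))) ⟩
      p ^ 2 * P + 1 * q ∎
      where
      open ≤-Reasoning
      g h : Vec (𝔽 p) 2 → ℕ
      g y = δ (lookup y zero) * P
      h y = δ (𝟙 ⊕ lookup y zero) * (nz (lookup y (suc zero)) * P)
      bound : ∀ y → fibre e₁ y + g y + h y ≤ P + δ (lookup y zero) * nz (lookup y (suc zero))
      bound (a ∷ b ∷ []) = fibre-e₁ a b
      ∑-zero : ∑ ys g ≡ 1 * (p * P)
      ∑-zero = trans (∑-pairs δ (λ _ → P)) (cong₂ _*_ (∑-δ q) (∑-allFin-const p P))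
      ∑-minus : ∑ ys h ≡ 1 * (q * P)
      ∑-minus = trans (∑-pairs (λ a → δ (𝟙 ⊕ a)) (λ b → nz b * P))
        (cong₂ _*_ ∑-δ-𝟙⊕ (trans (∑-*ʳ (allFin p) nz P) (cong (_* P) (∑-nz q))))

-- Comparison of the weights

-- Here t = p ^ (k-1).  The hypotheses amount to A ≤ q² P + q and
-- B = q p P + 2 q, and q B then exceeds p A by at least q² - q.
two-minimal-≤ : ∀ s t A B → let q = 1 + s; p = 1 + q; P = p * t in
  A + 1 * (p * P) + 1 * (q * P) ≤ p ^ 2 * P + 1 * q →
  B + 1 + q ^ 2 ≡ p ^ 2 * (t * q + 1) →
  p * A ≤ q * B
two-minimal-≤ s t A B hA hB = begin
  p * A                              ≤⟨ ℕ.*-monoʳ-≤ p A≤ ⟩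
  p * (q * q * P + q)                ≤⟨ ℕ.m≤m+n _ (q * s) ⟩
  p * (q * q * P + q) + q * s        ≡⟨ gap s P ⟩
  q * (q * p * P + 2 * q)            ≡⟨ cong (q *_) B≡ ⟨
  q * B                              ∎
  where
  open ≤-Reasoning
  q = 1 + s
  p = 1 + q
  P = p * t
  gap : ∀ s P → (2 + s) * ((1 + s) * (1 + s) * P + (1 + s)) + (1 + s) * s
              ≡ (1 + s) * ((1 + s) * (2 + s) * P + 2 * (1 + s))
  gap = solve-∀
  expandA : ∀ q P → (1 + q) * ((1 + q) * 1) * P + 1 * q
                  ≡ q * q * P + q + (1 * ((1 + q) * P) + 1 * (q * P))
  expandA = solve-∀
  expandB : ∀ q t → (1 + q) * ((1 + q) * 1) * (t * q + 1)
                  ≡ q * (1 + q) * ((1 + q) * t) + 2 * q + (1 + q * (q * 1))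
  expandB = solve-∀
  A≤ : A ≤ q * q * P + q
  A≤ = ℕ.+-cancelʳ-≤ (1 * (p * P) + 1 * (q * P)) A (q * q * P + q) (begin
    A + (1 * (p * P) + 1 * (q * P))            ≡⟨ ℕ.+-assoc A (1 * (p * P)) (1 * (q * P)) ⟨
    A + 1 * (p * P) + 1 * (q * P)              ≤⟨ hA ⟩
    p ^ 2 * P + 1 * q                          ≡⟨ expandA q P ⟩
    q * q * P + q + (1 * (p * P) + 1 * (q * P)) ∎)
  B≡ : B ≡ q * p * P + 2 * q
  B≡ = ℕ.+-cancelʳ-≡ (1 + q ^ 2) B (q * p * P + 2 * q)
    (trans (sym (ℕ.+-assoc B 1 (q ^ 2))) (trans hB (expandB q t)))

-- With d = p ^ (1+j) - q ^ (1+j), the second inequality says q ^ j ≤ d when q is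
-- positive.
power-gap : ∀ q j → ∃[ d ] (1 + q) ^ (1 + j) ≡ q ^ (1 + j) + d × q ^ (1 + j) ≤ q * d
power-gap q zero = 1 , ℕ.+-comm 1 (q * 1) , ℕ.≤-refl
power-gap q (suc j) with power-gap q j
... | d , eq , _ = b + d + q * d , trans (cong ((1 + q) *_) eq) (expand q b d)
                 , ℕ.*-monoʳ-≤ q (ℕ.≤-trans (ℕ.m≤m+n b d) (ℕ.m≤m+n (b + d) (q * d)))
  where
  b = q ^ (1 + j)
  expand : ∀ q b d → (1 + q) * (b + d) ≡ q * b + (b + d + q * d)
  expand = solve-∀

-- Here t = p ^ (k-1).  Writing b = q ^ (m-2) and p ^ (m-2) = b + d, the claim
-- becomes (2 q + 1) b + p² d ≤ p² q² d t + 1, which follows from b ≤ q d, t ≥ 1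
-- and (2 q + 1) q + p² ≤ p² q²; the last inequality needs q ≥ 2.
many-minimal-≤ : ∀ r j t .{{_ : NonZero t}} A B → let q = 2 + r; p = 1 + q; m = 3 + j; P = p * t in
  A + 1 + q ^ m ≡ p ^ m + q ^ m * P →
  B + 1 + q ^ m ≡ p ^ m * (t * q + 1) →
  p * A ≤ q * B
many-minimal-≤ r j t A B hA hB with power-gap (2 + r) j
... | d , a≡b+d , b≤qd = ℕ.+-cancelʳ-≤ (p * (1 + c)) (p * A) (q * B) (begin
  p * A + p * (1 + c)                        ≡⟨ collectA p A c ⟩
  p * (A + 1 + c)                            ≡⟨ cong (p *_) hA ⟩
  p * (p * (p * a) + c * (p * t))            ≡⟨ cong (λ a → p * (p * (p * a) + c * (p * t))) a≡b+d ⟩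
  X                                          ≤⟨ X≤Y ⟩
  Y
    ≡⟨ cong (λ a → q * (p * (p * a) * (t * q + 1)) + (1 + c)) a≡b+d ⟨
  q * (p * (p * a) * (t * q + 1)) + (1 + c)  ≡⟨ cong (λ w → q * w + (1 + c)) hB ⟨
  q * (B + 1 + c) + (1 + c)                  ≡⟨ collectB q B c ⟩
  q * B + p * (1 + c)                        ∎)
  where
  open ≤-Reasoning
  q p a b c X Y : ℕ
  q = 2 + r
  p = 1 + q
  a = p ^ (1 + j)
  b = q ^ (1 + j)
  c = q * (q * b)
  X = p * (p * (p * (b + d)) + c * (p * t))
  Y = q * (p * (p * (b + d)) * (t * q + 1)) + (1 + c)
  collectA : ∀ p A c → p * A + p * (1 + c) ≡ p * (A + 1 + c)
  collectA = solve-∀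
  collectB : ∀ q B c → q * (B + 1 + c) + (1 + c) ≡ q * B + (1 + q) * (1 + c)
  collectB = solve-∀
  difference : ∀ q b d t →
    (1 + q) * ((1 + q) * ((1 + q) * (b + d)) + q * (q * b) * ((1 + q) * t))
      + ((1 + q) * (1 + q) * (q * q) * d * t + 1)
    ≡ q * ((1 + q) * ((1 + q) * (b + d)) * (t * q + 1)) + (1 + q * (q * b))
      + ((2 * q + 1) * b + (1 + q) * (1 + q) * d)
  difference = solve-∀
  -- p² q² - p² - (2 q + 1) q, written as a polynomial in r = q - 2, has only
  -- nonnegative coefficients.
  quartic : ∀ r d → (2 * (2 + r) + 1) * ((2 + r) * d) + (3 + r) * (3 + r) * d
                    + (r * r * r * r + 10 * (r * r * r) + 34 * (r * r) + 45 * r + 17) * d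
                  ≡ (3 + r) * (3 + r) * ((2 + r) * (2 + r)) * d
  quartic = solve-∀
  rest : ℕ
  rest = r * r * r * r + 10 * (r * r * r) + 34 * (r * r) + 45 * r + 17
  small : (2 * q + 1) * b + p * p * d ≤ p * p * (q * q) * d * t + 1
  small = begin
    (2 * q + 1) * b + p * p * d
      ≤⟨ ℕ.+-monoˡ-≤ (p * p * d) (ℕ.*-monoʳ-≤ (2 * q + 1) b≤qd) ⟩
    (2 * q + 1) * (q * d) + p * p * d              ≤⟨ ℕ.m≤m+n _ (rest * d) ⟩
    (2 * q + 1) * (q * d) + p * p * d + rest * d   ≡⟨ quartic r d ⟩
    p * p * (q * q) * d                            ≤⟨ ℕ.m≤m*n _ t ⟩
    p * p * (q * q) * d * t                        ≤⟨ ℕ.m≤m+n _ 1 ⟩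
    p * p * (q * q) * d * t + 1                    ∎
  X≤Y : X ≤ Y
  X≤Y = ℕ.+-cancelʳ-≤ (p * p * (q * q) * d * t + 1) X Y (begin
    X + (p * p * (q * q) * d * t + 1)    ≡⟨ difference q b d t ⟩
    Y + ((2 * q + 1) * b + p * p * d)    ≤⟨ ℕ.+-monoʳ-≤ Y small ⟩
    Y + (p * p * (q * q) * d * t + 1)    ∎)

-- The two cases

-- The modulus p = r + 3 ranges over all integers at least 3.
module _ (r k-1 : ℕ) where

  open Arithmetic (suc r)

  charIdeals-violates : ∀ m → 2 ≤ m → (I : Multiset p (m + suc k-1)) → (∀ i → toℕ (lookup I i) ≡ q) →
    ViolatesAshikhminBarg p
      (codeOf p (charIdeals (Hierarchical≼ m (m + suc k-1)) (hierarchical≼? m (m + suc k-1)) I))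
  charIdeals-violates 1 (s≤s ()) _ _
  charIdeals-violates 2 _ I I-full = violates-by e₁ e-tail (wt≢0 e₁ (e₁-dot {suc (suc k-1)} 𝟘 (𝟙 ∷ 𝟎)))
    (two-minimal-≤ (suc r) (p ^ k-1) (wt e₁) (wt e-tail) wt-e₁ wt-e-tail)
    where
    isSplit = charIdeals-isSplitIndicator 2 (suc k-1) I I-full
    open Words 0 k-1 _ isSplit
    open TwoMinimal k-1 _ isSplit
  charIdeals-violates (suc (suc (suc j))) _ I I-full = violates-by 𝟎 e-tail (wt≢0 𝟎 (𝟎-dot witness))
    (many-minimal-≤ r j (p ^ k-1) {{ℕ.m^n≢0 p k-1}} (wt 𝟎) (wt e-tail) wt-𝟎 wt-e-tail)
    where
    open Words (suc j) k-1 _ (charIdeals-isSplitIndicator (3 + j) (suc k-1) I I-full)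

≤-∸1⇒∃ : ∀ {m n} → 0 < n → m ≤ n ∸ 1 → ∃[ o ] m + suc o ≡ n
≤-∸1⇒∃ {m} {suc n} _ m≤n with o , m+o≡n ← ℕ.m≤n⇒∃[o]m+o≡n m≤n = o , trans (+-suc m o) (cong suc m+o≡n)

proposition5p8 : ∀ (p : ℕ) .{{_ : NonZero p}} → Prime p → ¬ (2 ∣ p) →
    ∀ (n m : ℕ) → n ≥ 3 → 2 ≤ m → m ≤ n ∸ 1 →
    ∀ (I : Multiset p n) → IsUnsaturatedIdeal (Hierarchical≼ m n) I →
    (∀ i → toℕ (lookup I i) ≡ p ∸ 1) →
    ViolatesAshikhminBarg p (codeOf p (charIdeals (Hierarchical≼ m n) (hierarchical≼? m n) I))
proposition5p8 0 p-prime _ = contradiction p-prime ¬prime[0]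
proposition5p8 1 p-prime _ = contradiction p-prime ¬prime[1]
proposition5p8 2 _ 2∤p = contradiction ∣-refl 2∤p
proposition5p8 (suc (suc (suc r))) _ _ n m n≥3 2≤m m≤n-1 I _ I-full
  with k-1 , refl ← ≤-∸1⇒∃ {m} (ℕ.≤-trans (s≤s z≤n) n≥3) m≤n-1
  = charIdeals-violates r k-1 m 2≤m I I-full
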